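{- Let $g_1,f_1,g_2,f_2\in\mathcal{F}_0$. Then $$\{g_1,f_1\}\cdot\{g_2,f_2\}=\left\{g_1\left(\frac{x}{f_2(x)}\right)g_2(x),\ \frac{x}{\left(\frac{x}{f_1(x)}\right)\circ\left(\frac{x}{f_2(x)}\right)}\right\}.$$
   Context: All power series are formal power series in $x$ with coefficients in $\mathbb{Q}$. $\mathcal{F}_0$ is the set of series $a_0+a_1x+a_2x^2+\cdots$ with $a_0\neq 0$; $\mathcal{F}_1$ is the set of series $a_1x+a_2x^2+\cdots$ with $a_1\ne 0$. $[x^m]$ extracts the coefficient of $x^m$ (and is $0$ for $m<0$). For $g,f\in\mathcal{F}_0$, $\{g,f\}$ denotes the infinite lower-triangular matrix, indexed by $n,k\ge0$, with $(n,k)$ entry $[x^{n-k}]\,g(x)f(x)^n$. The product $\cdot$ is matrix multiplication. $\circ$ denotes composition of power series: $(a\circ b)(x)=a(b(x))$. The quotient $x/w$ for $w\in\mathcal{F}_1$ is understood as a power series after cancelling the factor $x$. -}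

module Defs where

open import Data.Fin.Base using (Fin; zero; suc; toℕ)
open import Data.Fin.Properties using (toℕ≤pred[n])
open import Data.Integer.Base as ℤ using (ℤ; +_; -[1+_]; _⊖_)
import Data.Integer.Properties as ℤ
open import Data.Nat.Base as ℕ using (ℕ; zero; suc; _∸_)
import Data.Nat.Properties as ℕ
open import Data.Rational.Base using (ℚ; 0ℚ; 1ℚ; _+_; _*_; -_; 1/_; NonZero; ≢-nonZero)
open import Data.Rational.Properties
open import Data.Vec.Base using (Vec; []; _∷_; head; lookup)
open import Algebra.Bundles using (CommutativeRing)
open import Relation.Binary.PropositionalEquality

open import Algebra.Properties.Semiring.Sum
  (CommutativeRing.semiring +-*-commutativeRing)

infixl 7 _⊛_ _⊛₀_ _·_
infixr 8 _^_
infixr 9 _∘ₛ_ _∘₀_ _∘₁_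
infix  4 _≈_

-- Σ aₙ xⁿ is represented by its coefficient sequence n ↦ aₙ.
PowerSeries : Set
PowerSeries = ℕ → ℚ

[x^_] : ℤ → PowerSeries → ℚ
[x^ + m      ] a = a m
[x^ -[1+ _ ] ] a = 0ℚ

one : PowerSeries
one zero    = 1ℚ
one (suc _) = 0ℚ

_⊛_ : PowerSeries → PowerSeries → PowerSeries
(a ⊛ b) n = ∑[ i ≤ n ] (a (toℕ i) * b (n ∸ toℕ i))

_^_ : PowerSeries → ℕ → PowerSeries
a ^ zero  = one
a ^ suc n = a ⊛ a ^ n

shiftUp : PowerSeries → PowerSeries
shiftUp a zero    = 0ℚ
shiftUp a (suc n) = a n

shiftDown : PowerSeries → PowerSeries
shiftDown a n = a (suc n)

record F₀ : Set where
  constructor mkF₀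
  field
    series     : PowerSeries
    constant≢0 : series 0 ≢ 0ℚ

record F₁ : Set where
  constructor mkF₁
  field
    series     : PowerSeries
    constant≡0 : series 0 ≡ 0ℚ
    linear≢0   : series 1 ≢ 0ℚ

-- Since b ∈ F₁ has no constant term, bⁱ does not contribute to xⁿ for i > n,
-- so the sum defining [xⁿ] a(b(x)) may stop at i = n.
_∘ₛ_ : PowerSeries → F₁ → PowerSeries
(a ∘ₛ b) n = ∑[ i ≤ n ] (a (toℕ i) * (F₁.series b ^ toℕ i) n)

-- The coefficients bₙ , … , b₁ , b₀ of 1/a, in this order, from
--   b₀ = 1/a₀  and  bₙ₊₁ = - (1/a₀) Σ_{i ≤ n} aᵢ₊₁ bₙ₋ᵢ.
invCoeffs : (a : PowerSeries) .{{_ : NonZero (a 0)}} (n : ℕ) → Vec ℚ (suc n)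
invCoeffs a zero    = 1/ (a 0) ∷ []
invCoeffs a (suc n) =
  - (1/ (a 0) * (∑[ i ≤ n ] (a (suc (toℕ i)) * lookup (invCoeffs a n) i))) ∷ invCoeffs a n

inv : (a : PowerSeries) .{{_ : NonZero (a 0)}} → PowerSeries
inv a n = head (invCoeffs a n)

lookup-invCoeffs : (a : PowerSeries) .{{_ : NonZero (a 0)}} (n : ℕ) (i : Fin (suc n)) →
                   lookup (invCoeffs a n) i ≡ inv a (n ∸ toℕ i)
lookup-invCoeffs a zero    zero    = refl
lookup-invCoeffs a (suc n) zero    = refl
lookup-invCoeffs a (suc n) (suc i) = lookup-invCoeffs a n i

⊛-inverseʳ : (a : PowerSeries) .{{_ : NonZero (a 0)}} → a ⊛ inv a ≗ one
⊛-inverseʳ a zero    = trans (+-identityʳ _) (*-inverseʳ (a 0))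
⊛-inverseʳ a (suc n) = begin
  a 0 * - (1/ (a 0) * S) + T      ≡⟨ cong (_+ T) (sym (neg-distribʳ-* (a 0) _)) ⟩
  - (a 0 * (1/ (a 0) * S)) + T    ≡⟨ cong (λ z → - z + T) (sym (*-assoc (a 0) _ S)) ⟩
  - (a 0 * 1/ (a 0) * S) + T      ≡⟨ cong (λ z → - (z * S) + T) (*-inverseʳ (a 0)) ⟩
  - (1ℚ * S) + T                  ≡⟨ cong (λ z → - z + T) (*-identityˡ S) ⟩
  - S + T                         ≡⟨ cong (λ z → - z + T) S≡T ⟩
  - T + T                         ≡⟨ +-inverseˡ T ⟩
  0ℚ                              ∎
  where
  open ≡-Reasoning
  S = ∑[ i ≤ n ] (a (suc (toℕ i)) * lookup (invCoeffs a n) i)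
  T = ∑[ i ≤ n ] (a (suc (toℕ i)) * inv a (n ∸ toℕ i))
  S≡T : S ≡ T
  S≡T = sum-cong-≗ λ i → cong (a (suc (toℕ i)) *_) (lookup-invCoeffs a n i)

*-≢0 : ∀ {p q} → p ≢ 0ℚ → q ≢ 0ℚ → p * q ≢ 0ℚ
*-≢0 {p} {q} p≢0 q≢0 pq≡0 = q≢0 (begin
  q                 ≡⟨ *-identityˡ q ⟨
  1ℚ * q            ≡⟨ cong (_* q) (*-inverseˡ p) ⟨
  1/ p * p * q      ≡⟨ *-assoc (1/ p) p q ⟩
  1/ p * (p * q)    ≡⟨ cong (1/ p *_) pq≡0 ⟩
  1/ p * 0ℚ         ≡⟨ *-zeroʳ (1/ p) ⟩
  0ℚ                ∎)
  where
  open ≡-Reasoning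
  instance
    p-nonZero : NonZero p
    p-nonZero = ≢-nonZero p≢0

1/-≢0 : ∀ p .{{_ : NonZero p}} → 1/ p ≢ 0ℚ
1/-≢0 p 1/p≡0 = 1≢0 (trans (sym (*-inverseʳ p)) (trans (cong (p *_) 1/p≡0) (*-zeroʳ p)))

_⊛₀_ : F₀ → F₀ → F₀
mkF₀ a a₀≢0 ⊛₀ mkF₀ b b₀≢0 = mkF₀ (a ⊛ b)
  λ eq → *-≢0 a₀≢0 b₀≢0 (trans (sym (+-identityʳ _)) eq)

_∘₀_ : F₀ → F₁ → F₀
mkF₀ a a₀≢0 ∘₀ b = mkF₀ (a ∘ₛ b)
  λ eq → a₀≢0 (trans (sym (trans (+-identityʳ _) (*-identityʳ (a 0)))) eq)

_∘₁_ : F₁ → F₁ → F₁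
mkF₁ a a₀≡0 a₁≢0 ∘₁ b@(mkF₁ b′ b₀≡0 b₁≢0) = mkF₁ (a ∘ₛ b)
  (trans (+-identityʳ _) (trans (*-identityʳ (a 0)) a₀≡0))
  λ eq → *-≢0 a₁≢0 b₁≢0 (trans (sym linear) eq)
  where
  open ≡-Reasoning
  b¹₁ : (b′ ^ 1) 1 ≡ b′ 1
  b¹₁ = begin
    b′ 0 * 0ℚ + (b′ 1 * 1ℚ + 0ℚ)  ≡⟨ cong₂ _+_ (*-zeroʳ (b′ 0)) (+-identityʳ (b′ 1 * 1ℚ)) ⟩
    0ℚ + b′ 1 * 1ℚ                ≡⟨ +-identityˡ _ ⟩
    b′ 1 * 1ℚ                     ≡⟨ *-identityʳ (b′ 1) ⟩
    b′ 1                          ∎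
  linear : (a ∘ₛ b) 1 ≡ a 1 * b′ 1
  linear = begin
    a 0 * 0ℚ + (a 1 * (b′ ^ 1) 1 + 0ℚ)  ≡⟨ cong₂ _+_ (*-zeroʳ (a 0)) (+-identityʳ (a 1 * (b′ ^ 1) 1)) ⟩
    0ℚ + a 1 * (b′ ^ 1) 1               ≡⟨ +-identityˡ _ ⟩
    a 1 * (b′ ^ 1) 1                    ≡⟨ cong (a 1 *_) b¹₁ ⟩
    a 1 * b′ 1                          ∎

-- x / f = x · (1/f)
x/₀_ : F₀ → F₁
x/₀ mkF₀ f f₀≢0 = mkF₁ (shiftUp (inv f)) refl (1/-≢0 (f 0))
  where
  instance
    f₀-nonZero : NonZero (f 0)
    f₀-nonZero = ≢-nonZero f₀≢0

-- x / w = 1 / (w/x)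
x/₁_ : F₁ → F₀
x/₁ mkF₁ w _ w₁≢0 = mkF₀ (inv (shiftDown w)) (1/-≢0 (w 1))
  where
  instance
    w₁-nonZero : NonZero (w 1)
    w₁-nonZero = ≢-nonZero w₁≢0

record LowerTriangular : Set where
  constructor mkLT
  field
    entry           : ℕ → ℕ → ℚ
    lowerTriangular : ∀ {n k} → n ℕ.< k → entry n k ≡ 0ℚ

open LowerTriangular public using (entry)

_≈_ : LowerTriangular → LowerTriangular → Set
A ≈ B = ∀ n k → entry A n k ≡ entry B n k

-- The row A n j vanishes for j > n, so the matrix product sum stops at j = n.
_·_ : LowerTriangular → LowerTriangular → LowerTriangular
mkLT A _ · mkLT B B-lower = mkLT
  (λ n k → ∑[ j ≤ n ] (A n (toℕ j) * B (toℕ j) k))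
  λ {n} {k} n<k → trans
    (sum-cong-≗ {suc n} λ j → trans
      (cong (A n (toℕ j) *_) (B-lower (ℕ.≤-<-trans (toℕ≤pred[n] j) n<k)))
      (*-zeroʳ (A n (toℕ j))))
    (sum-replicate-zero (suc n))

[x^n⊖k]≡0 : ∀ (a : PowerSeries) {n k} → n ℕ.< k → [x^ n ⊖ k ] a ≡ 0ℚ
[x^n⊖k]≡0 a {n} {k} n<k = trans (cong (λ m → [x^ m ] a) (ℤ.⊖-< n<k)) (negative (ℕ.m<n⇒0<n∸m n<k))
  where
  negative : ∀ {m} → 0 ℕ.< m → [x^ ℤ.- (+ m) ] a ≡ 0ℚ
  negative {suc _} _ = refl

-- The matrix written {g , f}; n ⊖ k is the difference n - k in ℤ.
⟦_,_⟧ : F₀ → F₀ → LowerTriangular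
⟦ mkF₀ g _ , mkF₀ f _ ⟧ = mkLT
  (λ n k → [x^ n ⊖ k ] (g ⊛ f ^ n))
  λ {n} → [x^n⊖k]≡0 (g ⊛ f ^ n)

{-# OPTIONS --safe #-}
-- Put u = x/f₂.  The second component of the right-hand side is x f₁(u)/u = f₁(u) f₂, so with
-- h = g₁ f₁ⁿ the claim is that Σⱼ [xⁿ⁻ʲ]h · [xʲ⁻ᵏ]g₂f₂ʲ equals [xⁿ⁻ᵏ] h(u) g₂ f₂ⁿ.
-- Writing h = h₀ + x h′ gives h(u) f₂ⁿ⁺¹ = h₀ f₂ⁿ⁺¹ + x h′(u) f₂ⁿ, and this follows by induction on n.
module Submission where

open import Algebra.Bundles using (CommutativeMonoid; CommutativeRing)
import Algebra.Properties.CommutativeSemigroup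
open import Data.Fin.Base using (Fin; toℕ)
open import Data.Fin.Properties using (toℕ≤pred[n]; toℕ-inject₁; toℕ-fromℕ)
open import Data.Integer.Base as ℤ using (_⊖_)
open import Data.Integer.Properties using ([1+m]⊖[1+n]≡m⊖n; ⊖-≥; n⊖n≡0)
open import Data.Nat.Base as ℕ using (ℕ; zero; suc; _∸_; z≤n; s≤s)
import Data.Nat.Properties as ℕ
open import Data.Product.Base using (_,_)
open import Data.Rational.Base using (ℚ; 0ℚ; 1ℚ; _+_; _*_; NonZero; ≢-nonZero)
open import Data.Rational.Properties
open import Function.Base using (_∘_)
open import Relation.Binary.Bundles using (Setoid)
open import Relation.Binary.PropositionalEquality
import Relation.Binary.Reasoning.Setoid

open import Algebra.Properties.Semiring.Sum
  (CommutativeRing.semiring +-*-commutativeRing)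
module ℚ-* = Algebra.Properties.CommutativeSemigroup
  (CommutativeRing.*-commutativeSemigroup +-*-commutativeRing)
module ℚ-+ = Algebra.Properties.CommutativeSemigroup
  (CommutativeMonoid.commutativeSemigroup +-0-commutativeMonoid)

open import Defs

infixl 6 _⊕_
infixl 8 _∙_

-- Finite sums of rationals.

∑-linear : ∀ {n} s (a c t : Fin n → ℚ) →
  ∑[ i < n ] ((s * a i + c i) * t i) ≡ s * ∑[ i < n ] (a i * t i) + ∑[ i < n ] (c i * t i)
∑-linear s a c t = begin
  ∑[ i < _ ] ((s * a i + c i) * t i)
    ≡⟨ sum-cong-≗ (λ i → trans (*-distribʳ-+ (t i) (s * a i) (c i)) (cong (_+ c i * t i) (*-assoc s (a i) (t i)))) ⟩
  ∑[ i < _ ] (s * (a i * t i) + c i * t i)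
    ≡⟨ ∑-distrib-+ (λ i → s * (a i * t i)) (λ i → c i * t i) ⟩
  ∑[ i < _ ] (s * (a i * t i)) + ∑[ i < _ ] (c i * t i)
    ≡⟨ cong (_+ ∑[ i < _ ] (c i * t i)) (*-distribˡ-sum s (λ i → a i * t i)) ⟨
  s * ∑[ i < _ ] (a i * t i) + ∑[ i < _ ] (c i * t i) ∎
  where open ≡-Reasoning

∑≤-suc : ∀ (t : ℕ → ℚ) n → ∑[ i ≤ suc n ] t (toℕ i) ≡ ∑[ i ≤ n ] t (toℕ i) + t (suc n)
∑≤-suc t n = trans (sum-init-last {suc n} (t ∘ toℕ))
  (cong₂ _+_ (sum-cong-≗ {suc n} λ i → cong t (toℕ-inject₁ i)) (cong t (toℕ-fromℕ (suc n))))

∑-zero : ∀ {n} (t : Fin n → ℚ) → (∀ i → t i ≡ 0ℚ) → sum t ≡ 0ℚ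
∑-zero {n} t t≡0 = trans (sum-cong-≗ t≡0) (sum-replicate-zero n)

∑≤-truncate : ∀ (t : ℕ → ℚ) {m n} → (∀ {i} → m ℕ.< i → t i ≡ 0ℚ) → m ℕ.≤ n →
  ∑[ i ≤ n ] t (toℕ i) ≡ ∑[ i ≤ m ] t (toℕ i)
∑≤-truncate t {n = n} t≡0 z≤n =
  cong (t 0 +_) (∑-zero {n} (λ i → t (suc (toℕ i))) λ i → t≡0 (s≤s z≤n))
∑≤-truncate t t≡0 (s≤s m≤n) = cong (t 0 +_) (∑≤-truncate (t ∘ suc) (t≡0 ∘ s≤s) m≤n)

-- Power series as a commutative monoid under multiplication.

_∙_ : ℚ → PowerSeries → PowerSeries
(s ∙ a) n = s * a n

_⊕_ : PowerSeries → PowerSeries → PowerSeries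
(a ⊕ b) n = a n + b n

-- For use where two factors are known to agree only up to degree n, as with truncated compositions
-- and in strong inductions on the degree.
⊛-cong-≤ : ∀ {a a′ b b′ : PowerSeries} n → (∀ {m} → m ℕ.≤ n → a m ≡ a′ m) →
  (∀ {m} → m ℕ.≤ n → b m ≡ b′ m) → (a ⊛ b) n ≡ (a′ ⊛ b′) n
⊛-cong-≤ n a≡a′ b≡b′ = sum-cong-≗ {suc n} λ i →
  cong₂ _*_ (a≡a′ (toℕ≤pred[n] i)) (b≡b′ (ℕ.m∸n≤m n (toℕ i)))

⊛-cong : ∀ {a a′ b b′ : PowerSeries} → a ≗ a′ → b ≗ b′ → a ⊛ b ≗ a′ ⊛ b′
⊛-cong a≗a′ b≗b′ n = ⊛-cong-≤ n (λ {m} _ → a≗a′ m) (λ {m} _ → b≗b′ m)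

⊛-congˡ : ∀ a {b b′ : PowerSeries} → b ≗ b′ → a ⊛ b ≗ a ⊛ b′
⊛-congˡ a = ⊛-cong {a} λ _ → refl

⊛-congʳ : ∀ b {a a′ : PowerSeries} → a ≗ a′ → a ⊛ b ≗ a′ ⊛ b
⊛-congʳ b a≗a′ = ⊛-cong {b = b} a≗a′ λ _ → refl

-- The shape `s ∙ a ⊕ b` is that of the tail of a product: `shiftDown (a ⊛ b)` unfolds to
-- `a 0 ∙ shiftDown b ⊕ shiftDown a ⊛ b`.
⊛-linearˡ : ∀ s a b c → (s ∙ a ⊕ b) ⊛ c ≗ s ∙ (a ⊛ c) ⊕ b ⊛ c
⊛-linearˡ s a b c n =
  ∑-linear {suc n} s (a ∘ toℕ) (b ∘ toℕ) (λ i → c (n ∸ toℕ i))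

-- The mirror image of the defining recursion (a ⊛ b) (suc n) = a 0 * b (suc n) + (shiftDown a ⊛ b) n.
⊛-sucʳ : ∀ a b n → (a ⊛ b) (suc n) ≡ b 0 * a (suc n) + (a ⊛ shiftDown b) n
⊛-sucʳ a b zero = begin
  a 0 * b 1 + (a 1 * b 0 + 0ℚ)  ≡⟨ cong (a 0 * b 1 +_) (trans (+-identityʳ _) (*-comm (a 1) (b 0))) ⟩
  a 0 * b 1 + b 0 * a 1         ≡⟨ +-comm (a 0 * b 1) _ ⟩
  b 0 * a 1 + a 0 * b 1         ≡⟨ cong (b 0 * a 1 +_) (+-identityʳ (a 0 * b 1)) ⟨
  b 0 * a 1 + (a 0 * b 1 + 0ℚ)  ∎
  where open ≡-Reasoning
⊛-sucʳ a b (suc n) = trans (cong (a 0 * b (suc (suc n)) +_) (⊛-sucʳ (shiftDown a) b n))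
  (ℚ-+.x∙yz≈y∙xz (a 0 * b (suc (suc n))) (b 0 * a (suc (suc n))) ((shiftDown a ⊛ shiftDown b) n))

-- The right-hand recursion `⊛-sucʳ` for `a ⊛ b` matches the defining recursion of `b ⊛ a`.
⊛-comm : ∀ a b → a ⊛ b ≗ b ⊛ a
⊛-comm a b zero    = cong (_+ 0ℚ) (*-comm (a 0) (b 0))
⊛-comm a b (suc n) = trans (⊛-sucʳ a b n) (cong (b 0 * a (suc n) +_) (⊛-comm a (shiftDown b) n))

⊛-assoc : ∀ a b c → (a ⊛ b) ⊛ c ≗ a ⊛ (b ⊛ c)
⊛-assoc a b c zero = cong (_+ 0ℚ) (begin
  (a 0 * b 0 + 0ℚ) * c 0  ≡⟨ cong (_* c 0) (+-identityʳ (a 0 * b 0)) ⟩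
  a 0 * b 0 * c 0         ≡⟨ *-assoc (a 0) (b 0) (c 0) ⟩
  a 0 * (b 0 * c 0)       ≡⟨ cong (a 0 *_) (+-identityʳ (b 0 * c 0)) ⟨
  a 0 * (b 0 * c 0 + 0ℚ)  ∎)
  where open ≡-Reasoning
⊛-assoc a b c (suc n) = begin
  (a ⊛ b) 0 * c (suc n) + (shiftDown (a ⊛ b) ⊛ c) n
    ≡⟨ cong₂ _+_ (trans (cong (_* c (suc n)) (+-identityʳ (a 0 * b 0))) (*-assoc (a 0) (b 0) (c (suc n))))
                 (⊛-linearˡ (a 0) (shiftDown b) (shiftDown a ⊛ b) c n) ⟩
  a 0 * (b 0 * c (suc n)) + (a 0 * (shiftDown b ⊛ c) n + ((shiftDown a ⊛ b) ⊛ c) n)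
    ≡⟨ +-assoc (a 0 * (b 0 * c (suc n))) (a 0 * (shiftDown b ⊛ c) n) (((shiftDown a ⊛ b) ⊛ c) n) ⟨
  a 0 * (b 0 * c (suc n)) + a 0 * (shiftDown b ⊛ c) n + ((shiftDown a ⊛ b) ⊛ c) n
    ≡⟨ cong₂ _+_ (sym (*-distribˡ-+ (a 0) _ _)) (⊛-assoc (shiftDown a) b c n) ⟩
  a 0 * (b ⊛ c) (suc n) + (shiftDown a ⊛ (b ⊛ c)) n ∎
  where open ≡-Reasoning

⊛-zeroˡ : ∀ {a : PowerSeries} b n → (∀ i → a i ≡ 0ℚ) → (a ⊛ b) n ≡ 0ℚ
⊛-zeroˡ b n a≡0 = ∑-zero {suc n} _ λ i →
  trans (cong (_* b (n ∸ toℕ i)) (a≡0 (toℕ i))) (*-zeroˡ (b (n ∸ toℕ i)))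

⊛-identityˡ : ∀ a → one ⊛ a ≗ a
⊛-identityˡ a zero    = trans (+-identityʳ (1ℚ * a 0)) (*-identityˡ (a 0))
⊛-identityˡ a (suc n) = trans
  (cong₂ _+_ (*-identityˡ (a (suc n))) (⊛-zeroˡ a n λ _ → refl))
  (+-identityʳ (a (suc n)))

⊛-commutativeMonoid : CommutativeMonoid _ _
⊛-commutativeMonoid = record
  { Carrier = PowerSeries
  ; _≈_ = _≗_
  ; _∙_ = _⊛_
  ; ε = one
  ; isCommutativeMonoid = record
    { isMonoid = record
      { isSemigroup = record
        { isMagma = record { isEquivalence = Setoid.isEquivalence (ℕ →-setoid ℚ) ; ∙-cong = ⊛-cong }
        ; assoc = ⊛-assoc
        }
      ; identity = ⊛-identityˡ , λ a n → trans (⊛-comm a one n) (⊛-identityˡ a n)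
      }
    ; comm = ⊛-comm
    }
  }

module ⊛ where
  open CommutativeMonoid ⊛-commutativeMonoid public
    using (setoid; identityʳ) renaming (refl to ≗-refl; sym to ≗-sym; trans to ≗-trans)
  open Algebra.Properties.CommutativeSemigroup
    (CommutativeMonoid.commutativeSemigroup ⊛-commutativeMonoid) public

module ≗-Reasoning = Relation.Binary.Reasoning.Setoid ⊛.setoid

-- Powers and reciprocals of series.

^-cong : ∀ {a b : PowerSeries} n → a ≗ b → a ^ n ≗ b ^ n
^-cong zero    a≗b = ⊛.≗-refl
^-cong (suc n) a≗b = ⊛-cong a≗b (^-cong n a≗b)

^-distrib-⊛ : ∀ a b n → (a ⊛ b) ^ n ≗ a ^ n ⊛ b ^ n
^-distrib-⊛ a b zero    = ⊛.≗-sym (⊛-identityˡ one)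
^-distrib-⊛ a b (suc n) = ⊛.≗-trans (⊛-congˡ (a ⊛ b) (^-distrib-⊛ a b n)) (⊛.interchange a b (a ^ n) (b ^ n))

-- Identifies a reciprocal by checking one product, without touching the recursion for its
-- coefficients.
inv-unique : ∀ a .{{_ : NonZero (a 0)}} {b} → a ⊛ b ≗ one → inv a ≗ b
inv-unique a {b} ab≗1 = begin
  inv a            ≈⟨ ⊛.identityʳ (inv a) ⟨
  inv a ⊛ one      ≈⟨ ⊛-congˡ (inv a) ab≗1 ⟨
  inv a ⊛ (a ⊛ b)  ≈⟨ ⊛.x∙yz≈yx∙z (inv a) a b ⟩
  a ⊛ inv a ⊛ b    ≈⟨ ⊛-congʳ b (⊛-inverseʳ a) ⟩
  one ⊛ b          ≈⟨ ⊛-identityˡ b ⟩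
  b                ∎
  where open ≗-Reasoning

⊛-∑ : ∀ {N} (w : PowerSeries) (s : Fin N → ℚ) (t : Fin N → PowerSeries) →
  w ⊛ (λ m → ∑[ i < N ] (s i * t i m)) ≗ λ n → ∑[ i < N ] (s i * (w ⊛ t i) n)
⊛-∑ {N} w s t n = begin
  ∑[ j ≤ n ] (w (toℕ j) * ∑[ i < N ] (s i * t i (n ∸ toℕ j)))
    ≡⟨ sum-cong-≗ {suc n} (λ j → *-distribˡ-sum (w (toℕ j)) (λ i → s i * t i (n ∸ toℕ j))) ⟩
  ∑[ j ≤ n ] ∑[ i < N ] (w (toℕ j) * (s i * t i (n ∸ toℕ j)))
    ≡⟨ ∑-comm {suc n} {N} (λ j i → w (toℕ j) * (s i * t i (n ∸ toℕ j))) ⟩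
  ∑[ i < N ] ∑[ j ≤ n ] (w (toℕ j) * (s i * t i (n ∸ toℕ j)))
    ≡⟨ sum-cong-≗ {N} (λ i → sum-cong-≗ {suc n} λ j → ℚ-*.x∙yz≈y∙xz (w (toℕ j)) (s i) (t i (n ∸ toℕ j))) ⟩
  ∑[ i < N ] ∑[ j ≤ n ] (s i * (w (toℕ j) * t i (n ∸ toℕ j)))
    ≡⟨ sum-cong-≗ {N} (λ i → *-distribˡ-sum {suc n} (s i) (λ j → w (toℕ j) * t i (n ∸ toℕ j))) ⟨
  ∑[ i < N ] (s i * (w ⊛ t i) n) ∎
  where open ≡-Reasoning

-- Composition with a fixed series without constant term.

module Composition (b : F₁) where

  open F₁ b using () renaming (series to bₛ; constant≡0 to b₀≡0)

  b/x : PowerSeries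
  b/x = shiftDown bₛ

  b-⊛-suc : ∀ a n → (bₛ ⊛ a) (suc n) ≡ (b/x ⊛ a) n
  b-⊛-suc a n = trans
    (cong (_+ (b/x ⊛ a) n) (trans (cong (_* a (suc n)) b₀≡0) (*-zeroˡ (a (suc n)))))
    (+-identityˡ _)

  -- Each factor `bₛ` supplies one x: once `b-⊛-suc` has removed it, only coefficients of `bₛ ^ i`
  -- below its own order remain.
  ^-order : ∀ i {m} → m ℕ.< i → (bₛ ^ i) m ≡ 0ℚ
  ^-order (suc i) {zero}  _         = trans (+-identityʳ _)
    (trans (cong (_* (bₛ ^ i) 0) b₀≡0) (*-zeroˡ ((bₛ ^ i) 0)))
  ^-order (suc i) {suc m} (s≤s m<i) = trans (b-⊛-suc (bₛ ^ i) m) (∑-zero {suc m} _ λ j →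
    trans (cong (b/x (toℕ j) *_) (^-order i (ℕ.≤-<-trans (ℕ.m∸n≤m m (toℕ j)) m<i)))
          (*-zeroʳ (b/x (toℕ j))))

  -- By `^-order` the terms beyond i = m vanish. A common cutoff n for all coefficients up to degree
  -- n lets `⊛-∑`, whose range is fixed, apply to a composition.
  ∘ₛ-extend : ∀ a {m n} → m ℕ.≤ n → ∑[ i ≤ n ] (a (toℕ i) * (bₛ ^ toℕ i) m) ≡ (a ∘ₛ b) m
  ∘ₛ-extend a {m} = ∑≤-truncate (λ i → a i * (bₛ ^ i) m)
    (λ {i} m<i → trans (cong (a i *_) (^-order i m<i)) (*-zeroʳ (a i)))

  ∘ₛ-zero : ∀ a → (a ∘ₛ b) 0 ≡ a 0
  ∘ₛ-zero a = trans (+-identityʳ _) (*-identityʳ (a 0))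

  -- Writing a = a₀ + x a′ gives a(b) = a₀ + b a′(b), and removing a₀ and dividing by x leaves (b/x)
  -- a′(b). Both the multiplicativity of composition and the later cancellation of f₂ rest on this
  -- recursion.
  ∘ₛ-shiftDown : ∀ a → shiftDown (a ∘ₛ b) ≗ b/x ⊛ (shiftDown a ∘ₛ b)
  ∘ₛ-shiftDown a n = begin
    a 0 * 0ℚ + ∑[ i ≤ n ] (a′ (toℕ i) * (bₛ ⊛ bₛ ^ toℕ i) (suc n))
      ≡⟨ cong₂ _+_ (*-zeroʳ (a 0)) (sum-cong-≗ {suc n} λ i → cong (a′ (toℕ i) *_) (b-⊛-suc (bₛ ^ toℕ i) n)) ⟩
    0ℚ + ∑[ i ≤ n ] (a′ (toℕ i) * (b/x ⊛ bₛ ^ toℕ i) n)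
      ≡⟨ +-identityˡ _ ⟩
    ∑[ i ≤ n ] (a′ (toℕ i) * (b/x ⊛ bₛ ^ toℕ i) n)
      ≡⟨ ⊛-∑ {suc n} b/x (a′ ∘ toℕ) (λ i → bₛ ^ toℕ i) n ⟨
    (b/x ⊛ (λ m → ∑[ i ≤ n ] (a′ (toℕ i) * (bₛ ^ toℕ i) m))) n
      ≡⟨ ⊛-cong-≤ {b/x} n (λ _ → refl) (∘ₛ-extend a′) ⟩
    (b/x ⊛ (a′ ∘ₛ b)) n ∎
    where
    open ≡-Reasoning
    a′ = shiftDown a

  ∘ₛ-linear : ∀ s a c → (s ∙ a ⊕ c) ∘ₛ b ≗ s ∙ (a ∘ₛ b) ⊕ c ∘ₛ b
  ∘ₛ-linear s a c n = ∑-linear {suc n} s (a ∘ toℕ) (c ∘ toℕ) (λ i → (bₛ ^ toℕ i) n)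

  ∘ₛ-cong : ∀ {a a′ : PowerSeries} → a ≗ a′ → a ∘ₛ b ≗ a′ ∘ₛ b
  ∘ₛ-cong a≗a′ n = sum-cong-≗ {suc n} λ i → cong (_* (bₛ ^ toℕ i) n) (a≗a′ (toℕ i))

  one-∘ₛ : one ∘ₛ b ≗ one
  one-∘ₛ zero    = ∘ₛ-zero one
  one-∘ₛ (suc n) = trans (cong (1ℚ * 0ℚ +_) (∑-zero {suc n} _ λ i → *-zeroˡ ((bₛ ^ suc (toℕ i)) (suc n))))
    (trans (+-identityʳ (1ℚ * 0ℚ)) (*-identityˡ 0ℚ))

  private
    -- Strong induction on the degree, phrased with a bound n: degree m + 1 involves, through a
    -- product with `b/x`, the claim for `shiftDown a` in all degrees up to m.
    ∘ₛ-distrib-⊛-≤ : ∀ n a c {m} → m ℕ.≤ n → ((a ⊛ c) ∘ₛ b) m ≡ ((a ∘ₛ b) ⊛ (c ∘ₛ b)) m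
    ∘ₛ-distrib-⊛-≤ n a c {zero} _ = begin
      ((a ⊛ c) ∘ₛ b) 0              ≡⟨ ∘ₛ-zero (a ⊛ c) ⟩
      a 0 * c 0 + 0ℚ                ≡⟨ cong (_+ 0ℚ) (cong₂ _*_ (∘ₛ-zero a) (∘ₛ-zero c)) ⟨
      (a ∘ₛ b) 0 * (c ∘ₛ b) 0 + 0ℚ  ∎
      where open ≡-Reasoning
    ∘ₛ-distrib-⊛-≤ (suc n) a c {suc m} (s≤s m≤n) = begin
      ((a ⊛ c) ∘ₛ b) (suc m)
        ≡⟨ ∘ₛ-shiftDown (a ⊛ c) m ⟩
      (b/x ⊛ (shiftDown (a ⊛ c) ∘ₛ b)) m
        -- The tail of `a ⊛ c` is by definition `a 0 ∙ c′ ⊕ a′ ⊛ c`, so linearity of composition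
        -- applies at once.
        ≡⟨ ⊛-congˡ b/x (∘ₛ-linear (a 0) c′ (a′ ⊛ c)) m ⟩
      (b/x ⊛ (a 0 ∙ (c′ ∘ₛ b) ⊕ (a′ ⊛ c) ∘ₛ b)) m
        ≡⟨ ⊛-comm b/x (a 0 ∙ (c′ ∘ₛ b) ⊕ (a′ ⊛ c) ∘ₛ b) m ⟩
      ((a 0 ∙ (c′ ∘ₛ b) ⊕ (a′ ⊛ c) ∘ₛ b) ⊛ b/x) m
        ≡⟨ ⊛-linearˡ (a 0) (c′ ∘ₛ b) ((a′ ⊛ c) ∘ₛ b) b/x m ⟩
      a 0 * ((c′ ∘ₛ b) ⊛ b/x) m + (((a′ ⊛ c) ∘ₛ b) ⊛ b/x) m
        ≡⟨ cong₂ _+_ (cong₂ _*_ (sym (∘ₛ-zero a)) head≡) tail≡ ⟩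
      (a ∘ₛ b) 0 * (c ∘ₛ b) (suc m) + (shiftDown (a ∘ₛ b) ⊛ (c ∘ₛ b)) m ∎
      where
      open ≡-Reasoning
      a′ = shiftDown a
      c′ = shiftDown c
      head≡ : ((c′ ∘ₛ b) ⊛ b/x) m ≡ (c ∘ₛ b) (suc m)
      head≡ = trans (⊛-comm (c′ ∘ₛ b) b/x m) (sym (∘ₛ-shiftDown c m))
      tail≡ : (((a′ ⊛ c) ∘ₛ b) ⊛ b/x) m ≡ (shiftDown (a ∘ₛ b) ⊛ (c ∘ₛ b)) m
      tail≡ = begin
        (((a′ ⊛ c) ∘ₛ b) ⊛ b/x) m
          ≡⟨ ⊛-cong-≤ m (λ l≤m → ∘ₛ-distrib-⊛-≤ n a′ c (ℕ.≤-trans l≤m m≤n)) (λ {l} _ → refl {x = b/x l}) ⟩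
        ((a′ ∘ₛ b) ⊛ (c ∘ₛ b) ⊛ b/x) m
          ≡⟨ ⊛.xy∙z≈zx∙y (a′ ∘ₛ b) (c ∘ₛ b) b/x m ⟩
        (b/x ⊛ (a′ ∘ₛ b) ⊛ (c ∘ₛ b)) m
          ≡⟨ ⊛-congʳ (c ∘ₛ b) (∘ₛ-shiftDown a) m ⟨
        (shiftDown (a ∘ₛ b) ⊛ (c ∘ₛ b)) m ∎

  ∘ₛ-distrib-⊛ : ∀ a c → (a ⊛ c) ∘ₛ b ≗ (a ∘ₛ b) ⊛ (c ∘ₛ b)
  ∘ₛ-distrib-⊛ a c n = ∘ₛ-distrib-⊛-≤ n a c ℕ.≤-refl

  ∘ₛ-distrib-^ : ∀ a n → (a ^ n) ∘ₛ b ≗ (a ∘ₛ b) ^ n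
  ∘ₛ-distrib-^ a zero    = one-∘ₛ
  ∘ₛ-distrib-^ a (suc n) = ⊛.≗-trans (∘ₛ-distrib-⊛ a (a ^ n)) (⊛-congˡ (a ∘ₛ b) (∘ₛ-distrib-^ a n))

-- Coefficient extraction at integer exponents.

[x^]-cong : ∀ m {a b : PowerSeries} → a ≗ b → [x^ m ] a ≡ [x^ m ] b
[x^]-cong (ℤ.+ m)    a≗b = a≗b m
[x^]-cong ℤ.-[1+ m ] a≗b = refl

-- The bound on j matters: at j = n + 1 the left side is `a 0`, while the right side extracts a
-- negative power and is 0.
[x^suc⊖]-shiftDown : ∀ (a : PowerSeries) {n j} → j ℕ.≤ n → [x^ suc n ⊖ j ] a ≡ [x^ n ⊖ j ] (shiftDown a)
[x^suc⊖]-shiftDown a {n} {j} j≤n = begin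
  [x^ suc n ⊖ j ] a          ≡⟨ cong (λ m → [x^ m ] a) (⊖-≥ (ℕ.m≤n⇒m≤1+n j≤n)) ⟩
  a (suc n ∸ j)              ≡⟨ cong a (ℕ.+-∸-assoc 1 j≤n) ⟩
  shiftDown a (n ∸ j)        ≡⟨ cong (λ m → [x^ m ] (shiftDown a)) (⊖-≥ j≤n) ⟨
  [x^ n ⊖ j ] (shiftDown a)  ∎
  where open ≡-Reasoning

-- For k ≤ n this is the defining recursion of the product. At k = n + 1 the last term extracts a
-- negative power, and its 0 is the empty tail of the sum for the constant coefficient. For larger k
-- everything vanishes.
[x^suc⊖]-⊛ : ∀ a b n k →
  [x^ suc n ⊖ k ] (a ⊛ b) ≡ a 0 * [x^ suc n ⊖ k ] b + [x^ n ⊖ k ] (shiftDown a ⊛ b)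
[x^suc⊖]-⊛ a b n       zero          = refl
[x^suc⊖]-⊛ a b zero    (suc zero)    = refl
[x^suc⊖]-⊛ a b zero    (suc (suc k)) = sym (trans (+-identityʳ (a 0 * 0ℚ)) (*-zeroʳ (a 0)))
[x^suc⊖]-⊛ a b (suc n) (suc k)
  rewrite [1+m]⊖[1+n]≡m⊖n (suc n) k | [1+m]⊖[1+n]≡m⊖n n k = [x^suc⊖]-⊛ a b n k

-- Row sums of the matrix product, and the second component.

⊛-inverseˡ : ∀ a .{{_ : NonZero (a 0)}} → inv a ⊛ a ≗ one
⊛-inverseˡ a = ⊛.≗-trans (⊛-comm (inv a) a) (⊛-inverseʳ a)

module _ (g f : PowerSeries) (f₀≢0 : f 0 ≢ 0ℚ) where

  private
    instance
      f₀-nonZero : NonZero (f 0)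
      f₀-nonZero = ≢-nonZero f₀≢0

  u : F₁
  u = x/₀ mkF₀ f f₀≢0

  open Composition u

  -- For u = x/f the series `b/x` is `inv f`, so taking the tail of `h ∘ₛ u` produces a factor 1/f,
  -- which cancels one of the n + 1 factors f.
  ∘ₛ-⊛-cancel : ∀ h n → shiftDown (h ∘ₛ u) ⊛ (g ⊛ f ^ suc n) ≗ (shiftDown h ∘ₛ u) ⊛ (g ⊛ f ^ n)
  ∘ₛ-⊛-cancel h n = begin
    shiftDown (h ∘ₛ u) ⊛ (g ⊛ (f ⊛ f ^ n))
      ≈⟨ ⊛-cong (∘ₛ-shiftDown h) (⊛.x∙yz≈y∙xz g f (f ^ n)) ⟩
    (inv f ⊛ h′u) ⊛ (f ⊛ (g ⊛ f ^ n))
      ≈⟨ ⊛.interchange (inv f) h′u f (g ⊛ f ^ n) ⟩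
    (inv f ⊛ f) ⊛ (h′u ⊛ (g ⊛ f ^ n))
      ≈⟨ ⊛-congʳ (h′u ⊛ (g ⊛ f ^ n)) (⊛-inverseˡ f) ⟩
    one ⊛ (h′u ⊛ (g ⊛ f ^ n))
      ≈⟨ ⊛-identityˡ (h′u ⊛ (g ⊛ f ^ n)) ⟩
    h′u ⊛ (g ⊛ f ^ n) ∎
    where
    open ≗-Reasoning
    h′u = shiftDown h ∘ₛ u

  -- Keeping h arbitrary lets the induction on n pass to `shiftDown h`. The theorem takes h = g₁
  -- f₁ⁿ, whose exponent stays fixed during this induction.
  ∑-rows : ∀ h n k →
    ∑[ j ≤ n ] ([x^ n ⊖ toℕ j ] h * [x^ toℕ j ⊖ k ] (g ⊛ f ^ toℕ j)) ≡
    [x^ n ⊖ k ] ((h ∘ₛ u) ⊛ (g ⊛ f ^ n))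
  ∑-rows h zero    zero    = cong (λ z → z * (g ⊛ one) 0 + 0ℚ) (sym (∘ₛ-zero h))
  ∑-rows h zero    (suc k) = trans (+-identityʳ (h 0 * 0ℚ)) (*-zeroʳ (h 0))
  ∑-rows h (suc n) k = begin
    ∑[ j ≤ suc n ] ([x^ suc n ⊖ toℕ j ] h * row (toℕ j))
      -- The term j = n + 1 is split off because it alone involves the constant coefficient of h;
      -- the others see only the tail.
      ≡⟨ ∑≤-suc (λ j → [x^ suc n ⊖ j ] h * row j) n ⟩
    ∑[ j ≤ n ] ([x^ suc n ⊖ toℕ j ] h * row (toℕ j)) + [x^ suc n ⊖ suc n ] h * row (suc n)
      ≡⟨ cong₂ _+_
           (sum-cong-≗ {suc n} λ j → cong (_* row (toℕ j)) ([x^suc⊖]-shiftDown h (toℕ≤pred[n] j)))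
           (cong (λ m → [x^ m ] h * row (suc n)) (n⊖n≡0 (suc n))) ⟩
    ∑[ j ≤ n ] ([x^ n ⊖ toℕ j ] (shiftDown h) * row (toℕ j)) + h 0 * row (suc n)
      ≡⟨ cong₂ _+_ (∑-rows (shiftDown h) n k) (cong (_* row (suc n)) (sym (∘ₛ-zero h))) ⟩
    [x^ n ⊖ k ] ((shiftDown h ∘ₛ u) ⊛ (g ⊛ f ^ n)) + (h ∘ₛ u) 0 * row (suc n)
      ≡⟨ cong (_+ (h ∘ₛ u) 0 * row (suc n)) ([x^]-cong (n ⊖ k) (∘ₛ-⊛-cancel h n)) ⟨
    [x^ n ⊖ k ] (shiftDown (h ∘ₛ u) ⊛ (g ⊛ f ^ suc n)) + (h ∘ₛ u) 0 * row (suc n)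
      ≡⟨ +-comm ([x^ n ⊖ k ] (shiftDown (h ∘ₛ u) ⊛ (g ⊛ f ^ suc n))) ((h ∘ₛ u) 0 * row (suc n)) ⟩
    (h ∘ₛ u) 0 * row (suc n) + [x^ n ⊖ k ] (shiftDown (h ∘ₛ u) ⊛ (g ⊛ f ^ suc n))
      ≡⟨ [x^suc⊖]-⊛ (h ∘ₛ u) (g ⊛ f ^ suc n) n k ⟨
    [x^ suc n ⊖ k ] ((h ∘ₛ u) ⊛ (g ⊛ f ^ suc n)) ∎
    where
    open ≡-Reasoning
    row : ℕ → ℚ
    row j = [x^ j ⊖ k ] (g ⊛ f ^ j)

-- With v = x/f₂ and w = (x/f₁)(v), the left side is the reciprocal of w/x, and `∘ₛ-shiftDown` gives
-- w/x = (1/f₂) · (1/f₁)(v). Its product with f₂ · f₁(v) is 1 because composition is multiplicative.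
x/[x/f₁∘x/f₂] : ∀ f₁ f₂ → F₀.series (x/₁ ((x/₀ f₁) ∘₁ (x/₀ f₂))) ≗ F₀.series f₂ ⊛ (F₀.series f₁ ∘ₛ x/₀ f₂)
x/[x/f₁∘x/f₂] f₁@(mkF₀ a a₀≢0) f₂@(mkF₀ b b₀≢0) = inv-unique (shiftDown (F₁.series w)) (begin
  shiftDown (F₁.series w) ⊛ (b ⊛ (a ∘ₛ v))
    ≈⟨ ⊛-congʳ (b ⊛ (a ∘ₛ v)) (∘ₛ-shiftDown (F₁.series (x/₀ f₁))) ⟩
  (inv b ⊛ (inv a ∘ₛ v)) ⊛ (b ⊛ (a ∘ₛ v))
    ≈⟨ ⊛.interchange (inv b) (inv a ∘ₛ v) b (a ∘ₛ v) ⟩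
  (inv b ⊛ b) ⊛ ((inv a ∘ₛ v) ⊛ (a ∘ₛ v))
    ≈⟨ ⊛-cong (⊛-inverseˡ b) (⊛.≗-sym (∘ₛ-distrib-⊛ (inv a) a)) ⟩
  one ⊛ ((inv a ⊛ a) ∘ₛ v)
    ≈⟨ ⊛-identityˡ ((inv a ⊛ a) ∘ₛ v) ⟩
  (inv a ⊛ a) ∘ₛ v
    ≈⟨ ∘ₛ-cong (⊛-inverseˡ a) ⟩
  one ∘ₛ v
    ≈⟨ one-∘ₛ ⟩
  one ∎)
  where
  open ≗-Reasoning
  v = x/₀ f₂
  w = (x/₀ f₁) ∘₁ v
  open Composition v
  instance
    a₀-nonZero : NonZero (a 0)
    a₀-nonZero = ≢-nonZero a₀≢0
    b₀-nonZero : NonZero (b 0)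
    b₀-nonZero = ≢-nonZero b₀≢0
    w₁-nonZero : NonZero (F₁.series w 1)
    w₁-nonZero = ≢-nonZero (F₁.linear≢0 w)

proposition19 : (g₁ f₁ g₂ f₂ : F₀) →
    ⟦ g₁ , f₁ ⟧ · ⟦ g₂ , f₂ ⟧ ≈ ⟦ (g₁ ∘₀ (x/₀ f₂)) ⊛₀ g₂ , x/₁ ((x/₀ f₁) ∘₁ (x/₀ f₂)) ⟧
proposition19 (mkF₀ g₁ _) f₁@(mkF₀ a _) (mkF₀ g₂ _) f₂@(mkF₀ b b₀≢0) n k =
  -- What remains is an identity of series: (g₁ f₁ⁿ)(v) · g₂ f₂ⁿ = g₁(v) g₂ · (f₂ f₁(v))ⁿ, with v =
  -- x/f₂.
  trans (∑-rows g₂ b b₀≢0 (g₁ ⊛ a ^ n) n k) ([x^]-cong (n ⊖ k) (begin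
    ((g₁ ⊛ a ^ n) ∘ₛ v) ⊛ (g₂ ⊛ b ^ n)
      ≈⟨ ⊛-congʳ (g₂ ⊛ b ^ n) (∘ₛ-distrib-⊛ g₁ (a ^ n)) ⟩
    ((g₁ ∘ₛ v) ⊛ ((a ^ n) ∘ₛ v)) ⊛ (g₂ ⊛ b ^ n)
      ≈⟨ ⊛-congʳ (g₂ ⊛ b ^ n) (⊛-congˡ (g₁ ∘ₛ v) (∘ₛ-distrib-^ a n)) ⟩
    ((g₁ ∘ₛ v) ⊛ (a ∘ₛ v) ^ n) ⊛ (g₂ ⊛ b ^ n)
      ≈⟨ ⊛.interchange (g₁ ∘ₛ v) ((a ∘ₛ v) ^ n) g₂ (b ^ n) ⟩
    ((g₁ ∘ₛ v) ⊛ g₂) ⊛ ((a ∘ₛ v) ^ n ⊛ b ^ n)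
      ≈⟨ ⊛-congˡ ((g₁ ∘ₛ v) ⊛ g₂) (⊛-comm ((a ∘ₛ v) ^ n) (b ^ n)) ⟩
    ((g₁ ∘ₛ v) ⊛ g₂) ⊛ (b ^ n ⊛ (a ∘ₛ v) ^ n)
      ≈⟨ ⊛-congˡ ((g₁ ∘ₛ v) ⊛ g₂) (^-distrib-⊛ b (a ∘ₛ v) n) ⟨
    ((g₁ ∘ₛ v) ⊛ g₂) ⊛ (b ⊛ (a ∘ₛ v)) ^ n
      ≈⟨ ⊛-congˡ ((g₁ ∘ₛ v) ⊛ g₂) (^-cong n (x/[x/f₁∘x/f₂] f₁ f₂)) ⟨
    ((g₁ ∘ₛ v) ⊛ g₂) ⊛ F₀.series (x/₁ ((x/₀ f₁) ∘₁ v)) ^ n ∎))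
  where
  open ≗-Reasoning
  v = x/₀ f₂
  open Composition v
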